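{- Let $G$ be a graph of order $n\ge 4$ such that both $G$ and its complement $\overline G$ are connected. Then: (1) $\operatorname{th}_{\operatorname{Z}}(G)+\operatorname{th}_{\operatorname{Z}}(\overline G)\le 2(n-1)$ and $\operatorname{th}_{\operatorname{Z}}(G)\cdot\operatorname{th}_{\operatorname{Z}}(\overline G)\le (n-1)^2$. (2) $\operatorname{th}_{\operatorname{Z}}^{\ast}(G)+\operatorname{th}_{\operatorname{Z}}^{\ast}(\overline G)\le 2(n-2)$ and $\operatorname{th}_{\operatorname{Z}}^{\ast}(G)\cdot\operatorname{th}_{\operatorname{Z}}^{\ast}(\overline G)\le (n-2)^2$. All bounds are sharp, i.e., each is attained by infinitely many graphs $G$ such that both $G$ and $\overline G$ are connected.
   Context: Graphs are finite, simple, undirected, with nonempty vertex set; the order of $G$ is $|V(G)|$; $\overline G$ is the complement of $G$. Standard zero forcing: each vertex is filled or unfilled. Color change rule: if $w$ is the unique unfilled neighbor of a filled vertex $v$, then fill $w$. For $B\subseteq V(G)$ put $B^{[0]}=B$, and let $B^{[i+1]}$ be $B^{[i]}$ together with all vertices that can be filled by one application of the rule when exactly the vertices of $B^{[i]}$ are filled. $\operatorname{pt}_{\operatorname{Z}}(G;B)$ is the least $t$ with $B^{[t]}=V(G)$ ($\infty$ if none exists), and $\operatorname{pt}_{\operatorname{Z}}(G,k)=\min_{|B|=k}\operatorname{pt}_{\operatorname{Z}}(G;B)$. For $G$ of order $n$: the sum throttling number is $\operatorname{th}_{\operatorname{Z}}(G)=\min_{1\le k\le n}(k+\operatorname{pt}_{\operatorname{Z}}(G,k))$,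 and, if $G$ has an edge, the no initial cost product throttling number is $\operatorname{th}_{\operatorname{Z}}^{\ast}(G)=\min_{1\le k\le n-1}k\cdot\operatorname{pt}_{\operatorname{Z}}(G,k)$. -}

module Defs where

open import Level using (0ℓ)
open import Data.Nat using (ℕ; zero; suc; _+_; _*_; _∸_; _≤_; _<_; s≤s; _≤?_)
import Data.Nat as ℕ
open import Data.Nat.Properties
  using (anyUpTo?; ≤-refl; ≤-reflexive; m≤n+m; m≤n*m; <⇒≱; ≮⇒≥)
open import Data.Nat.Induction using (<-rec)
open import Data.Fin using (Fin; zero; suc)
open import Data.Fin.Properties using (any?; all?) renaming (_≟_ to _≟ᶠ_)
open import Data.Fin.Subset using (Subset; _∈_; _∉_; _∪_; ∁; ⁅_⁆; ⊤; ∣_∣)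
open import Data.Fin.Subset.Properties
  using (_∈?_; anySubset?; ∣⊤∣≡n; ∣⁅x⁆∣≡1; ∣∁p∣≡n∸∣p∣; ∈⊤; ⊆⊤; ⊆-antisym; x∉p⇒x∈∁p;
         x∉∁p⇒x∈p; x∈⁅y⁆⇒x≡y; x≢y⇒x∉⁅y⁆; p⊆p∪q; q⊆p∪q; p⊆q⇒∣p∣≤∣q∣)
open import Data.Vec using (tabulate)
open import Data.Vec.Properties using (≡-dec; lookup⇒[]=; lookup∘tabulate)
import Data.Bool.Properties as Bool
open import Data.Product using (∃; ∃₂; Σ; _×_; _,_; proj₁; proj₂)
open import Function using (_∘_; _↔_; _⇔_; Inverse)
open import Relation.Binary using (Rel; Symmetric; Irreflexive)
import Relation.Binary as B
open import Relation.Binary.Construct.Closure.ReflexiveTransitive using (Star)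
open import Relation.Binary.PropositionalEquality
  using (_≡_; _≢_; refl; sym; trans; cong; subst)
open import Relation.Nullary using (yes; no; does; ¬_; ¬?; _×-dec_; _→-dec_; contradiction)
open import Relation.Nullary.Decidable using (map′; dec-true)
open import Relation.Unary using (Pred; Decidable)

------------------------------------------------------------------------
-- Least elements

IsLeast : Pred ℕ 0ℓ → Pred ℕ 0ℓ
IsLeast P m = P m × (∀ {k} → P k → m ≤ k)

isLeast? : {P : Pred ℕ 0ℓ} → Decidable P → Decidable (IsLeast P)
isLeast? P? m = map′
  (λ (Pm , none) → Pm , λ {k} Pk → ≮⇒≥ λ k<m → none (k , k<m , Pk))
  (λ (Pm , min) → Pm , λ (k , k<m , Pk) → <⇒≱ k<m (min Pk))
  (P? m ×-dec ¬? (anyUpTo? P? m))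

least : {P : Pred ℕ 0ℓ} → Decidable P → ∃ P → ∃ (IsLeast P)
least {P} P? (m , Pm) = <-rec (λ m → P m → ∃ (IsLeast P)) search m Pm
  where
  search : ∀ m → (∀ {k} → k < m → P k → ∃ (IsLeast P)) → P m → ∃ (IsLeast P)
  search m rec Pm with anyUpTo? P? m
  ... | yes (k , k<m , Pk) = rec k<m Pk
  ... | no none            = m , Pm , λ {k} Pk → ≮⇒≥ λ k<m → none (k , k<m , Pk)

------------------------------------------------------------------------
-- Finite simple graphs of order n

-- Adjacency is decidable, as it is for every finite graph classically.
record Graph (n : ℕ) : Set₁ where
  infix 4 _~_ _~?_
  field
    nonempty : 0 < n
    _~_      : Rel (Fin n) 0ℓ
    _~?_     : B.Decidable _~_
    ~-sym    : Symmetric _~_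
    ~-irrefl : Irreflexive _≡_ _~_

infix 8 _ᶜ
_ᶜ : ∀ {n} → Graph n → Graph n
G ᶜ = record
  { nonempty = nonempty
  ; _~_      = λ u v → u ≢ v × ¬ (u ~ v)
  ; _~?_     = λ u v → ¬? (u ≟ᶠ v) ×-dec ¬? (u ~? v)
  ; ~-sym    = λ (u≢v , u≁v) → u≢v ∘ sym , u≁v ∘ ~-sym
  ; ~-irrefl = λ u≡v (u≢v , _) → u≢v u≡v
  } where open Graph G

Connected : ∀ {n} → Graph n → Set
Connected G = ∀ u v → Star (Graph._~_ G) u v

HasEdge : ∀ {n} → Graph n → Set
HasEdge G = ∃₂ λ u v → Graph._~_ G u v

infix 4 _≅_
_≅_ : ∀ {m n} → Graph m → Graph n → Set
_≅_ {m} {n} G H = Σ (Fin m ↔ Fin n) λ φ →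
  ∀ u v → Graph._~_ G u v ⇔ Graph._~_ H (Inverse.to φ u) (Inverse.to φ v)

-- Infinitely many graphs, counted up to isomorphism.
InfinitelyMany : (∀ {n} → Graph n → Set) → Set₁
InfinitelyMany P = Σ (ℕ → ∃ Graph) λ F →
  (∀ i → P (proj₂ (F i))) ×
  (∀ {i j} → i ≢ j → ¬ (proj₂ (F i) ≅ proj₂ (F j)))

------------------------------------------------------------------------
-- Zero forcing; a set of filled vertices is a Subset n

module _ {n : ℕ} (G : Graph n) where
  open Graph G

  Fillable : Subset n → Pred (Fin n) 0ℓ
  Fillable B w = ∃ λ v → v ∈ B × v ~ w × w ∉ B × (∀ u → v ~ u → u ∉ B → u ≡ w)

  fillable? : ∀ B → Decidable (Fillable B)
  fillable? B w = any? λ v →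
    v ∈? B ×-dec v ~? w ×-dec ¬? (w ∈? B) ×-dec
    all? λ u → v ~? u →-dec ¬? (u ∈? B) →-dec u ≟ᶠ w

  step : Subset n → Subset n
  step B = B ∪ tabulate (λ w → does (fillable? B w))

  infix 9 _^[_]
  _^[_] : Subset n → ℕ → Subset n
  B ^[ zero ]  = B
  B ^[ suc i ] = step (B ^[ i ])

  Filled : Subset n → Pred ℕ 0ℓ
  Filled B t = B ^[ t ] ≡ ⊤

  -- Propagation times take values in ℕ ∪ {∞}, so they are given as functional
  -- relations: PtSet B t says pt(G;B) = t, and Pt k t says pt(G,k) = t, for a
  -- finite t. The value ∞ is the case where no t is related; such terms do not
  -- contribute to the minima below.
  PtSet : Subset n → Pred ℕ 0ℓ
  PtSet B = IsLeast (Filled B)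

  Pt : ℕ → Pred ℕ 0ℓ
  Pt k = IsLeast (λ t → ∃ λ B → ∣ B ∣ ≡ k × PtSet B t)

  SumCost : Pred ℕ 0ℓ
  SumCost m = ∃₂ λ k t → 1 ≤ k × k ≤ n × Pt k t × m ≡ k + t

  ProductCost : Pred ℕ 0ℓ
  ProductCost m = ∃₂ λ k t → 1 ≤ k × k ≤ n ∸ 1 × Pt k t × m ≡ k * t

  ----------------------------------------------------------------------
  -- The minima exist

  filled? : ∀ B → Decidable (Filled B)
  filled? B t = ≡-dec Bool._≟_ (B ^[ t ]) ⊤

  ptCandidate? : ∀ k → Decidable (λ t → ∃ λ B → ∣ B ∣ ≡ k × PtSet B t)
  ptCandidate? k t = anySubset? λ B → ∣ B ∣ ℕ.≟ k ×-dec isLeast? (filled? B) t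

  pt? : ∀ k → Decidable (Pt k)
  pt? k = isLeast? (ptCandidate? k)

  sumCost? : Decidable SumCost
  sumCost? m = map′
    (λ (k , _ , t , _ , p) → k , t , p)
    (λ { (k , t , p@(_ , k≤n , _ , refl)) → k , s≤s k≤n , t , s≤s (m≤n+m t k) , p })
    (anyUpTo? (λ k → anyUpTo? (λ t →
      1 ≤? k ×-dec k ≤? n ×-dec pt? k t ×-dec m ℕ.≟ k + t) (suc m)) (suc n))

  productCost? : Decidable ProductCost
  productCost? m = map′
    (λ (k , _ , t , _ , p) → k , t , p)
    (λ { (suc k , t , p@(_ , k≤ , _ , refl)) →
           suc k , s≤s k≤ , t , s≤s (m≤n*m t (suc k)) , p })
    (anyUpTo? (λ k → anyUpTo? (λ t →
      1 ≤? k ×-dec k ≤? n ∸ 1 ×-dec pt? k t ×-dec m ℕ.≟ k * t) (suc m)) (suc (n ∸ 1)))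

  Filled⇒Pt : ∀ {t} B → Filled B t → ∃ (Pt ∣ B ∣)
  Filled⇒Pt {t} B filled =
    let s , ptB = least (filled? B) (t , filled)
    in least (ptCandidate? ∣ B ∣) (s , B , refl , ptB)

  Fillable⇒∈step : ∀ {B w} → Fillable B w → w ∈ step B
  Fillable⇒∈step {B} {w} f = q⊆p∪q B _
    (lookup⇒[]= w _ (trans (lookup∘tabulate _ w) (dec-true (fillable? B w) f)))

  sumCost-least : ∃ (IsLeast SumCost)
  sumCost-least =
    let t , pt = Filled⇒Pt {0} ⊤ refl
    in least sumCost?
         ( n + t , n , t , nonempty , ≤-refl
         , subst (λ k → Pt k t) (∣⊤∣≡n n) pt , refl )

  productCost-least : HasEdge G → ∃ (IsLeast ProductCost)
  productCost-least (v , w , v~w) =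
    let t , pt = Filled⇒Pt {1} B₀ B₀-fills
    in least productCost?
         ( ∣ B₀ ∣ * t , ∣ B₀ ∣ , t , 1≤∣B₀∣
         , ≤-reflexive (trans (∣∁p∣≡n∸∣p∣ ⁅ w ⁆) (cong (n ∸_) (∣⁅x⁆∣≡1 w)))
         , pt , refl )
    where
    B₀ : Subset n
    B₀ = ∁ ⁅ w ⁆

    v∈B₀ : v ∈ B₀
    v∈B₀ = x∉p⇒x∈∁p (x≢y⇒x∉⁅y⁆ λ v≡w → ~-irrefl v≡w v~w)

    1≤∣B₀∣ : 1 ≤ ∣ B₀ ∣
    1≤∣B₀∣ = subst (_≤ ∣ B₀ ∣) (∣⁅x⁆∣≡1 v)
      (p⊆q⇒∣p∣≤∣q∣ λ x∈ → subst (_∈ B₀) (sym (x∈⁅y⁆⇒x≡y v x∈)) v∈B₀)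

    covers : ∀ x → x ∈ step B₀
    covers x with x ∈? B₀
    ... | yes x∈ = p⊆p∪q _ x∈
    ... | no x∉ with x∈⁅y⁆⇒x≡y w (x∉∁p⇒x∈p x∉)
    ...   | refl = Fillable⇒∈step
      (v , v∈B₀ , v~w , x∉ , λ u _ u∉ → x∈⁅y⁆⇒x≡y w (x∉∁p⇒x∈p u∉))

    B₀-fills : Filled B₀ 1
    B₀-fills = ⊆-antisym ⊆⊤ (λ {x} _ → covers x)

------------------------------------------------------------------------
-- Throttling numbers

thZ : ∀ {n} → Graph n → ℕ
thZ G = proj₁ (sumCost-least G)

-- The value does not depend on the chosen edge, which only witnesses that the
-- minimum is finite.
thZ* : ∀ {n} (G : Graph n) → HasEdge G → ℕ
thZ* G e = proj₁ (productCost-least G e)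

{-# OPTIONS --safe #-}
-- Upper bounds: if every m ~ w satisfied N[m] ⊆ N[w] or N[w] ⊆ N[m], then, starting
-- anywhere and moving along induced paths m - w - u to ever larger closed
-- neighbourhoods, one would reach a vertex adjacent to all others, which the
-- connectedness of the complement forbids. So there are p, q with a neighbour
-- of p that is not one of q and vice versa. Then V ∖ {p, q} fills G in one step,
-- and it fills the complement in one step too, where the two neighbours swap roles.
--
-- Sharpness: take the path a - b - c with at least one leaf attached to c. Leaves
-- are twins, so a forcing set omits at most one of them. In the graph and in its
-- complement a forcing set omits at most three vertices, and at most two if it
-- needs a single step; these constraints give n - 1 and n - 2.
module Submission where

open import Defs
open import Data.Nat using (ℕ; _+_; _*_; _∸_; _^_; _≤_)
open import Data.Product using (Σ; _×_)
open import Relation.Binary.PropositionalEquality using (_≡_)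

open import Data.Bool using (Bool; true; false; T; T?; _∨_)
open import Data.Bool.Properties using (∨-comm)
open import Data.Empty using (⊥; ⊥-elim)
open import Data.Fin using (Fin; zero; suc; fromℕ<)
open import Data.Fin.Permutation using (↔⇒≡)
open import Data.Fin.Properties using (any?) renaming (_≟_ to _≟ᶠ_)
open import Data.Fin.Subset
  using (Subset; inside; outside; _∈_; _∉_; _⊂_; _⊃_; _-_; ∁; ⁅_⁆; ⊤; ∣_∣)
open import Data.Fin.Subset.Induction using (⊃-wellFounded)
open import Data.Fin.Subset.Properties
open import Data.List using (List; []; _∷_)
open import Data.List.Membership.Propositional renaming (_∈_ to _∈ˡ_) using ()
open import Data.List.Relation.Unary.All as All using (All; []; _∷_)
open import Data.List.Relation.Unary.Any using (here; there)
open import Data.Nat using (zero; suc; _<_; z≤n; s≤s)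
import Data.Nat.Properties as ℕ
open import Data.Product using (∃; ∃₂; _,_; proj₁; proj₂)
open import Data.Sum using (_⊎_; inj₁; inj₂; [_,_])
open import Data.Vec using (tabulate; []; _∷_; here; there)
open import Data.Vec.Properties using (lookup⇒[]=; []=⇒lookup; lookup∘tabulate)
open import Function using (_∘_)
open import Induction.WellFounded using (Acc; acc)
open import Level using (0ℓ)
open import Relation.Binary.Construct.Closure.ReflexiveTransitive
  using (Star; ε; _◅_; _◅◅_; reverse)
open import Relation.Binary.PropositionalEquality
  using (_≢_; refl; sym; trans; cong; cong₂; subst)
open import Relation.Nullary
  using (Dec; yes; no; does; ¬_; ¬?; _×-dec_; _⊎-dec_; contradiction)
open import Relation.Nullary.Decidable using (dec-true; decidable-stable)
open import Relation.Unary using (Pred; Decidable)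

-- Subsets

does⁻ : ∀ {P : Set} (P? : Dec P) → does P? ≡ true → P
does⁻ (yes p) _ = p

module _ {n} {P : Pred (Fin n) 0ℓ} (P? : Decidable P) where

  subset : Subset n
  subset = tabulate (does ∘ P?)

  ∈subset⁺ : ∀ {x} → P x → x ∈ subset
  ∈subset⁺ {x} Px =
    lookup⇒[]= x _ (trans (lookup∘tabulate _ x) (dec-true (P? x) Px))

  ∈subset⁻ : ∀ {x} → x ∈ subset → P x
  ∈subset⁻ {x} x∈ =
    does⁻ (P? x) (trans (sym (lookup∘tabulate _ x)) ([]=⇒lookup x∈))

∣p∣≥1 : ∀ {n} {p : Subset n} {x} → x ∈ p → 1 ≤ ∣ p ∣
∣p∣≥1 {p = p} {x} x∈p = subst (_≤ ∣ p ∣) (∣⁅x⁆∣≡1 x)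
  (p⊆q⇒∣p∣≤∣q∣ λ y∈ → subst (_∈ p) (sym (x∈⁅y⁆⇒x≡y x y∈)) x∈p)

all∈⇒∣p∣≡n : ∀ {n} {p : Subset n} → (∀ x → x ∈ p) → ∣ p ∣ ≡ n
all∈⇒∣p∣≡n {n} all∈ = trans (cong ∣_∣ (⊆-antisym ⊆⊤ λ {x} _ → all∈ x)) (∣⊤∣≡n n)

-- If some `i` is missing, the complement of `p` lies inside `⁅ i ⁆`. The missing index is returned
-- because further obstructions are built from it.
omits-at-most-one : ∀ {n} {p : Subset n} →
  (∀ {i j} → i ≢ j → i ∉ p → j ∉ p → ⊥) →
  n ≤ ∣ p ∣ ⊎ ∃ λ i → i ∉ p × n ≤ 1 + ∣ p ∣
omits-at-most-one {n} {p} no-two with any? (λ i → ¬? (i ∈? p))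
... | no none = inj₁ (ℕ.≤-reflexive (sym (all∈⇒∣p∣≡n
  λ x → decidable-stable (x ∈? p) λ x∉ → none (x , x∉))))
... | yes (i , i∉p) = inj₂ (i , i∉p , ℕ.≤-trans (ℕ.m≤n+m∸n n ∣ p ∣)
  (ℕ.≤-trans (ℕ.+-monoʳ-≤ ∣ p ∣ ∣∁p∣≤1) (ℕ.≤-reflexive (ℕ.+-comm ∣ p ∣ 1))))
  where
  ∁p⊆⁅i⁆ : ∀ {x} → x ∈ ∁ p → x ∈ ⁅ i ⁆
  ∁p⊆⁅i⁆ {x} x∈∁p with x ≟ᶠ i
  ... | yes refl = x∈⁅x⁆ i
  ... | no x≢i = ⊥-elim (no-two x≢i (x∈∁p⇒x∉p x∈∁p) i∉p)

  ∣∁p∣≤1 : n ∸ ∣ p ∣ ≤ 1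
  ∣∁p∣≤1 = subst (n ∸ ∣ p ∣ ≤_) (∣⁅x⁆∣≡1 i)
    (subst (_≤ ∣ ⁅ i ⁆ ∣) (∣∁p∣≡n∸∣p∣ p) (p⊆q⇒∣p∣≤∣q∣ ∁p⊆⁅i⁆))

-- Throttling numbers

module _ {n} (G : Graph n) where

  -- The number minimises over sizes, over sets of each size and over filling times. `B` and `t`
  -- bound all three minima, so any filling time serves, not only the least.
  thZ-≤ : ∀ B t → Filled G B t → 1 ≤ ∣ B ∣ → thZ G ≤ ∣ B ∣ + t
  thZ-≤ B t filled 1≤∣B∣ =
    let s , least-s = least (filled? G B) (t , filled)
        r , pt = Filled⇒Pt G {t} B filled
    in ℕ.≤-trans
      (proj₂ (proj₂ (sumCost-least G)) (∣ B ∣ , r , 1≤∣B∣ , ∣p∣≤n B , pt , refl))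
      (ℕ.+-monoʳ-≤ ∣ B ∣ (ℕ.≤-trans (proj₂ pt (B , refl , least-s)) (proj₂ least-s filled)))

  thZ*-≤ : ∀ e B t → Filled G B t → 1 ≤ ∣ B ∣ → ∣ B ∣ ≤ n ∸ 1 →
    thZ* G e ≤ ∣ B ∣ * t
  thZ*-≤ e B t filled 1≤∣B∣ ∣B∣<n =
    let s , least-s = least (filled? G B) (t , filled)
        r , pt = Filled⇒Pt G {t} B filled
    in ℕ.≤-trans
      (proj₂ (proj₂ (productCost-least G e)) (∣ B ∣ , r , 1≤∣B∣ , ∣B∣<n , pt , refl))
      (ℕ.*-monoʳ-≤ ∣ B ∣ (ℕ.≤-trans (proj₂ pt (B , refl , least-s)) (proj₂ least-s filled)))

  -- The minimum is attained by a concrete set with its propagation time, so bounding the cost of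
  -- every filling is enough.
  thZ-≥ : ∀ {m} → (∀ B t → Filled G B t → m ≤ ∣ B ∣ + t) → m ≤ thZ G
  thZ-≥ {m} bound = from-cost (proj₁ (proj₂ (sumCost-least G)))
    where
    from-cost : ∀ {r} → SumCost G r → m ≤ r
    from-cost (_ , t , _ , _ , ((B , refl , filled , _) , _) , refl) = bound B t filled

  -- The size restriction is handed on to the bound: the full set fills in `0` steps and would have
  -- product `0`.
  thZ*-≥ : ∀ e {m} → (∀ B t → ∣ B ∣ ≤ n ∸ 1 → Filled G B t → m ≤ ∣ B ∣ * t) →
    m ≤ thZ* G e
  thZ*-≥ e {m} bound = from-cost (proj₁ (proj₂ (productCost-least G e)))
    where
    from-cost : ∀ {r} → ProductCost G r → m ≤ r
    from-cost (_ , t , _ , ∣B∣<n , ((B , refl , filled , _) , _) , refl) =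
      bound B t ∣B∣<n filled

m+m≡2*m : ∀ m → m + m ≡ 2 * m
m+m≡2*m m = cong (m +_) (sym (ℕ.+-identityʳ m))

m*m≡m^2 : ∀ m → m * m ≡ m ^ 2
m*m≡m^2 m = cong (m *_) (sym (ℕ.*-identityʳ m))

m≤o∧n≤o⇒m+n≤2*o : ∀ {m n o} → m ≤ o → n ≤ o → m + n ≤ 2 * o
m≤o∧n≤o⇒m+n≤2*o {o = o} m≤o n≤o =
  ℕ.≤-trans (ℕ.+-mono-≤ m≤o n≤o) (ℕ.≤-reflexive (m+m≡2*m o))

m≤o∧n≤o⇒m*n≤o^2 : ∀ {m n o} → m ≤ o → n ≤ o → m * n ≤ o ^ 2
m≤o∧n≤o⇒m*n≤o^2 {o = o} m≤o n≤o =
  ℕ.≤-trans (ℕ.*-mono-≤ m≤o n≤o) (ℕ.≤-reflexive (m*m≡m^2 o))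

-- Upper bounds

module _ {n} (G : Graph n) where
  open Graph G

  Separates : Fin n → Fin n → Fin n → Set
  Separates p q x = x ~ p × x ≢ q × ¬ x ~ q

  -- In terms of neighbourhoods: neither N(p) ⊆ N[q] nor N(q) ⊆ N[p]. Whether `p` and `q` are
  -- adjacent is left open, so the notion passes to the complement.
  Incomparable : Fin n → Fin n → Set
  Incomparable p q = ∃ (Separates p q) × ∃ (Separates q p)

  fills-at-once : ∀ {B} → (∀ w → w ∉ B → Fillable G B w) → Filled G B 1
  fills-at-once {B} fillable = ⊆-antisym ⊆⊤ λ {w} _ → covers w
    where
    covers : ∀ w → w ∈ step G B
    covers w with w ∈? B
    ... | yes w∈ = p⊆p∪q _ w∈
    ... | no w∉ = Fillable⇒∈step G (fillable w w∉)

  -- One set serves both numbers: at most n - 2 filled vertices and a single step cost at most n - 1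
  -- as a sum and n - 2 as a product.
  incomparable⇒bounds : ∀ {p q} → Incomparable p q →
    thZ G ≤ n ∸ 1 × (∀ e → thZ* G e ≤ n ∸ 2)
  incomparable⇒bounds {p} {q} ((x , x~p , x≢q , x≁q) , (y , y~q , y≢p , y≁p)) =
    ℕ.≤-trans (thZ-≤ G B 1 filled 1≤∣B∣)
      (subst (_≤ n ∸ 1) (ℕ.+-comm 1 ∣ B ∣) (ℕ.∸-monoˡ-≤ 1 2+∣B∣≤n)) ,
    λ e → ℕ.≤-trans
      (thZ*-≤ G e B 1 filled 1≤∣B∣ (ℕ.≤-trans (ℕ.n≤1+n _) (ℕ.∸-monoˡ-≤ 1 2+∣B∣≤n)))
      (subst (_≤ n ∸ 2) (sym (ℕ.*-identityʳ ∣ B ∣)) (ℕ.∸-monoˡ-≤ 2 2+∣B∣≤n))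
    where
    B : Subset n
    B = ⊤ - p - q

    ∈B : ∀ {v} → v ≢ p → v ≢ q → v ∈ B
    ∈B v≢p v≢q = x∈p∧x≢y⇒x∈p-y (x∈p∧x≢y⇒x∈p-y ∈⊤ v≢p) v≢q

    p≢q : p ≢ q
    p≢q refl = x≁q x~p

    x∈B : x ∈ B
    x∈B = ∈B (λ x≡p → ~-irrefl x≡p x~p) x≢q

    y∈B : y ∈ B
    y∈B = ∈B y≢p (λ y≡q → ~-irrefl y≡q y~q)

    1≤∣B∣ : 1 ≤ ∣ B ∣
    1≤∣B∣ = ∣p∣≥1 x∈B

    2+∣B∣≤n : 2 + ∣ B ∣ ≤ n
    2+∣B∣≤n = ℕ.≤-trans
      (s≤s (x∈p⇒∣p-x∣<∣p∣ (x∈p∧x≢y⇒x∈p-y (∈⊤ {x = q}) (p≢q ∘ sym))))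
      (subst (∣ ⊤ - p ∣ <_) (∣⊤∣≡n n) (x∈p⇒∣p-x∣<∣p∣ (∈⊤ {x = p})))

    filled : Filled G B 1
    filled = fills-at-once fillable
      where
      fillable : ∀ w → w ∉ B → Fillable G B w
      fillable w w∉ with w ≟ᶠ p | w ≟ᶠ q
      ... | no w≢p | no w≢q = contradiction (∈B w≢p w≢q) w∉
      -- Only `p` and `q` are unfilled, and `x` is not adjacent to `q`.
      ... | yes refl | _ = x , x∈B , x~p , w∉ , only
        where
        only : ∀ u → x ~ u → u ∉ B → u ≡ p
        only u x~u u∉ with u ≟ᶠ p
        ... | yes u≡p = u≡p
        ... | no u≢p = contradiction (∈B u≢p λ { refl → x≁q x~u }) u∉
      ... | no _ | yes refl = y , y∈B , y~q , w∉ , only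
        where
        only : ∀ u → y ~ u → u ∉ B → u ≡ q
        only u y~u u∉ with u ≟ᶠ q
        ... | yes u≡q = u≡q
        ... | no u≢q = contradiction (∈B (λ { refl → y≁p y~u }) u≢q) u∉

  -- Existence of an incomparable pair

  exit-edge : ∀ {P : Pred (Fin n) 0ℓ} → Decidable P → ∀ {x y} → Star _~_ x y →
    P x → ¬ P y → ∃₂ λ v w → v ~ w × P v × ¬ P w
  exit-edge P? ε Px ¬Px = contradiction Px ¬Px
  exit-edge P? (_◅_ {j = z} x~z path) Px ¬Py with P? z
  ... | yes Pz = exit-edge P? path Pz ¬Py
  ... | no ¬Pz = _ , z , x~z , Px , ¬Pz

  Near : Fin n → Pred (Fin n) 0ℓ
  Near m v = m ≡ v ⊎ m ~ v

  near? : ∀ m → Decidable (Near m)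
  near? m v = m ≟ᶠ v ⊎-dec m ~? v

  -- Well-founded induction along strictly growing closed neighbourhoods. By `far` no vertex is
  -- adjacent to all others, so a path from `m` to a far vertex has an edge leaving the closed
  -- neighbourhood of `m`.
  incomparable-pair : Connected G → (∀ m → ∃ λ u → ¬ Near m u) → Fin n →
    ∃₂ Incomparable
  incomparable-pair connected far m₀ = search m₀ (⊃-wellFounded (subset (near? m₀)))
    where
    search : ∀ m → Acc _⊃_ (subset (near? m)) → ∃₂ Incomparable
    search m (acc rec) with
      exit-edge (near? m) (connected m (proj₁ (far m))) (inj₁ refl) (proj₂ (far m))
    -- The exit edge cannot start at `m`, whose neighbours are all near.
    ... | _ , u , m~u , inj₁ refl , u-far = contradiction (inj₂ m~u) u-far
    ... | w , u , w~u , inj₂ m~w , u-far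
      with any? (λ x → x ~? m ×-dec ¬? (x ≟ᶠ w) ×-dec ¬? (x ~? w))
    -- The vertex found sees `m` but not `w`; `u` sees `w` but not `m`.
    ... | yes separates = m , w , separates ,
      (u , ~-sym w~u , u-far ∘ inj₁ ∘ sym , u-far ∘ inj₂ ∘ ~-sym)
    -- With no such vertex N[m] ⊆ N[w], and `u` makes the inclusion strict.
    ... | no none = search w (rec N[m]⊂N[w])
      where
      near-w : ∀ x → Near m x → Near w x
      near-w x (inj₁ refl) = inj₂ (~-sym m~w)
      near-w x (inj₂ m~x) with near? w x
      ... | yes near = near
      ... | no x-far = contradiction
        (x , ~-sym m~x , x-far ∘ inj₁ ∘ sym , x-far ∘ inj₂ ∘ ~-sym) none

      N[m]⊂N[w] : subset (near? m) ⊂ subset (near? w)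
      N[m]⊂N[w] =
        (λ {x} x∈ → ∈subset⁺ (near? w) (near-w x (∈subset⁻ (near? m) x∈))) ,
        u , ∈subset⁺ (near? w) (inj₂ w~u) , u-far ∘ ∈subset⁻ (near? m)

-- `y` is distinct from `p` and not adjacent to it, hence a neighbour of `p` in the complement,
-- while `y ~ q` fails there. So `y` replaces `x`, and conversely.
incomparable-ᶜ : ∀ {n} (G : Graph n) {p q} → Incomparable G p q → Incomparable (G ᶜ) p q
incomparable-ᶜ G ((x , x~p , x≢q , x≁q) , (y , y~q , y≢p , y≁p)) =
  (y , (y≢p , y≁p) , (λ y≡q → ~-irrefl y≡q y~q) , λ (_ , y≁q) → y≁q y~q) ,
  (x , (x≢q , x≁q) , (λ x≡p → ~-irrefl x≡p x~p) , λ (_ , x≁p) → x≁p x~p)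
  where open Graph G

another : ∀ {n} → 2 ≤ n → (v : Fin n) → ∃ λ u → v ≢ u
another (s≤s (s≤s _)) zero = suc zero , λ ()
another (s≤s (s≤s _)) (suc v) = zero , λ ()

neighbour : ∀ {n} {G : Graph n} → 2 ≤ n → Connected G → ∀ v → ∃ (Graph._~_ G v)
neighbour 2≤n connected v with another 2≤n v
... | u , v≢u with connected v u
...   | ε = contradiction refl v≢u
...   | v~w ◅ _ = _ , v~w

module _ {n} (G : Graph n) (2≤n : 2 ≤ n) (con : Connected G) (conᶜ : Connected (G ᶜ)) where

  has-incomparable : ∃₂ (Incomparable G)
  has-incomparable = incomparable-pair G con far (fromℕ< (Graph.nonempty G))
    where
    far : ∀ m → ∃ λ u → ¬ Near G m u
    -- A neighbour of `m` in the complement is exactly a vertex outside its closed neighbourhood in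
    -- `G`.
    far m = let u , m≢u , m≁u = neighbour {G = G ᶜ} 2≤n conᶜ m in
      u , [ m≢u , m≁u ]

  upper : thZ G ≤ n ∸ 1 × (∀ e → thZ* G e ≤ n ∸ 2)
  upper = incomparable⇒bounds G (proj₂ (proj₂ has-incomparable))

  upperᶜ : thZ (G ᶜ) ≤ n ∸ 1 × (∀ e → thZ* (G ᶜ) e ≤ n ∸ 2)
  upperᶜ = incomparable⇒bounds (G ᶜ) (incomparable-ᶜ G (proj₂ (proj₂ has-incomparable)))

  hasEdge : HasEdge G
  hasEdge = v , neighbour {G = G} 2≤n con v
    where v = fromℕ< (Graph.nonempty G)

  hasEdgeᶜ : HasEdge (G ᶜ)
  hasEdgeᶜ = v , neighbour {G = G ᶜ} 2≤n conᶜ v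
    where v = fromℕ< (Graph.nonempty G)

-- Obstructions to forcing

module _ {n} (G : Graph n) where
  open Graph G

  -- To be read with all of `F` unfilled: a neighbour of `w` then either is unfilled itself or has a
  -- second unfilled neighbour, so none can force `w`.
  Blocked : List (Fin n) → Pred (Fin n) 0ℓ
  Blocked F w = ∀ v → v ~ w → v ∈ˡ F ⊎ ∃ λ u → u ∈ˡ F × u ≢ w × v ~ u

  -- The usual forts of zero forcing: no vertex outside `F` has exactly one neighbour in `F`.
  Fort : List (Fin n) → Set
  Fort F = All (Blocked F) F

  ∈step⁻ : ∀ {B w} → w ∈ step G B → w ∈ B ⊎ Fillable G B w
  ∈step⁻ {B} w∈ with x∈p∪q⁻ B _ w∈
  ... | inj₁ w∈B = inj₁ w∈B
  ... | inj₂ w∈f = inj₂ (∈subset⁻ (fillable? G B) w∈f)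

  blocked⇒∉step : ∀ {B F w} → All (_∉ B) F → Blocked F w → w ∉ B → w ∉ step G B
  blocked⇒∉step F∉ blocked w∉ w∈step with ∈step⁻ w∈step
  ... | inj₁ w∈ = w∉ w∈
  ... | inj₂ (v , v∈ , v~w , _ , only) with blocked v v~w
  ...   | inj₁ v∈F = All.lookup F∉ v∈F v∈
  ...   | inj₂ (u , u∈F , u≢w , v~u) = u≢w (only u v~u (All.lookup F∉ u∈F))

  -- For a single step one blocked vertex suffices; the rest of `F` only has to be unfilled at the
  -- start.
  blocked⇒not-at-once : ∀ {F w} → Blocked F w → w ∈ˡ F → ∀ B → Filled G B 1 →
    ¬ All (_∉ B) F
  blocked⇒not-at-once {w = w} blocked w∈F B filled F∉ =
    blocked⇒∉step F∉ blocked (All.lookup F∉ w∈F) (subst (w ∈_) (sym filled) ∈⊤)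

  -- The induction carries all of `F` together, since each vertex stays blocked only while the
  -- others are unfilled.
  fort-unfilled : ∀ {B F} → Fort F → All (_∉ B) F → ∀ t → All (_∉ (_^[_] G B t)) F
  fort-unfilled fort F∉ zero = F∉
  fort-unfilled fort F∉ (suc t) =
    All.zipWith (λ (blocked , w∉) → blocked⇒∉step (fort-unfilled fort F∉ t) blocked w∉)
      (fort , fort-unfilled fort F∉ t)

  -- The list is nonempty by form: the empty list is a fort too but obstructs nothing.
  fort⇒not-filled : ∀ B t {w F} → Fort (w ∷ F) → Filled G B t → ¬ All (_∉ B) (w ∷ F)
  fort⇒not-filled B t {w} fort filled F∉ =
    All.head (fort-unfilled fort F∉ t) (subst (w ∈_) (sym filled) ∈⊤)

-- Sharpness

pattern a = zero
pattern b = suc zero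
pattern c = suc (suc zero)
pattern leaf i = suc (suc (suc i))

record LowerBounds {n} (G : Graph n) : Set where
  constructor lower-bounds
  field
    thZ-lower : n ∸ 1 ≤ thZ G
    thZ*-lower : ∀ e → n ∸ 2 ≤ thZ* G e

open LowerBounds

-- One family serves all four sharpness claims: with matching upper bounds, each throttling number
-- of the graph and of its complement takes its maximal value separately.
record Extremal {n} (G : Graph n) : Set where
  field
    4≤n : 4 ≤ n
    connected : Connected G
    connectedᶜ : Connected (G ᶜ)
    lowerBounds : LowerBounds G
    lowerBoundsᶜ : LowerBounds (G ᶜ)

  2≤n : 2 ≤ n
  2≤n = ℕ.≤-trans (s≤s (s≤s z≤n)) 4≤n

  edge : HasEdge G
  edge = hasEdge G 2≤n connected connectedᶜ

  edgeᶜ : HasEdge (G ᶜ)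
  edgeᶜ = hasEdgeᶜ G 2≤n connected connectedᶜ

  thZ≡ : thZ G ≡ n ∸ 1
  thZ≡ = ℕ.≤-antisym (proj₁ (upper G 2≤n connected connectedᶜ)) (thZ-lower lowerBounds)

  thZᶜ≡ : thZ (G ᶜ) ≡ n ∸ 1
  thZᶜ≡ = ℕ.≤-antisym (proj₁ (upperᶜ G 2≤n connected connectedᶜ)) (thZ-lower lowerBoundsᶜ)

  thZ*≡ : ∀ e → thZ* G e ≡ n ∸ 2
  thZ*≡ e = ℕ.≤-antisym (proj₂ (upper G 2≤n connected connectedᶜ) e)
    (thZ*-lower lowerBounds e)

  thZ*ᶜ≡ : ∀ e → thZ* (G ᶜ) e ≡ n ∸ 2
  thZ*ᶜ≡ e = ℕ.≤-antisym (proj₂ (upperᶜ G 2≤n connected connectedᶜ) e)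
    (thZ*-lower lowerBoundsᶜ e)

-- The interface shared by the broom and its complement. `twins` leaves at most one leaf omitted and
-- `core` then limits all omissions to three. The last four hypotheses cover every kind of triple
-- that could still be omitted by a one-step filling.
module _ {k} (G : Graph (4 + k))
  (twins : ∀ {i j} → i ≢ j → Fort G (leaf i ∷ leaf j ∷ []))
  (core : ∀ i B t → Filled G B t → ¬ All (_∉ B) (a ∷ b ∷ c ∷ leaf i ∷ []))
  (abc : ∀ B → Filled G B 1 → ¬ All (_∉ B) (a ∷ b ∷ c ∷ []))
  (abl : ∀ i B → Filled G B 1 → ¬ All (_∉ B) (a ∷ b ∷ leaf i ∷ []))
  (acl : ∀ i B → Filled G B 1 → ¬ All (_∉ B) (a ∷ c ∷ leaf i ∷ []))
  (bcl : ∀ i B → Filled G B 1 → ¬ All (_∉ B) (b ∷ c ∷ leaf i ∷ []))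
  where

  leaves : ∀ x y z p t → Filled G (x ∷ y ∷ z ∷ p) t →
    1 + k ≤ ∣ p ∣ ⊎ ∃ λ i → i ∉ p × 1 + k ≤ 1 + ∣ p ∣
  leaves x y z p t filled = omits-at-most-one λ i≢j i∉ j∉ →
    fort⇒not-filled G (x ∷ y ∷ z ∷ p) t (twins i≢j) filled
      ((λ { (there (there (there i∈))) → i∉ i∈ }) ∷
       (λ { (there (there (there j∈))) → j∉ j∈ }) ∷ [])

  filled⇒n≤3+∣B∣ : ∀ B t → Filled G B t → 4 + k ≤ 3 + ∣ B ∣
  filled⇒n≤3+∣B∣ (x ∷ y ∷ z ∷ p) t filled with leaves x y z p t filled
  -- With every leaf present only `a`, `b` and `c` can be missing.
  ... | inj₁ full = s≤s (s≤s (s≤s (ℕ.≤-trans full (ℕ.≤-trans (∣p∣≤∣x∷p∣ z p)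
          (ℕ.≤-trans (∣p∣≤∣x∷p∣ y (z ∷ p)) (∣p∣≤∣x∷p∣ x (y ∷ z ∷ p)))))))
  ... | inj₂ (i , i∉ , most) = s≤s (s≤s (s≤s (ℕ.≤-trans most (extra x y z filled))))
    where
    extra : ∀ x y z → Filled G (x ∷ y ∷ z ∷ p) t → 1 + ∣ p ∣ ≤ ∣ x ∷ y ∷ z ∷ p ∣
    extra inside y z _ = s≤s (ℕ.≤-trans (∣p∣≤∣x∷p∣ z p) (∣p∣≤∣x∷p∣ y (z ∷ p)))
    extra outside inside z _ = s≤s (∣p∣≤∣x∷p∣ z p)
    extra outside outside inside _ = ℕ.≤-refl
    extra outside outside outside filled =
      ⊥-elim (core i (outside ∷ outside ∷ outside ∷ p) t filled
      ((λ ()) ∷ (λ { (there ()) }) ∷ (λ { (there (there ())) }) ∷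
       (λ { (there (there (there i∈))) → i∉ i∈ }) ∷ []))

  filled₁⇒n≤2+∣B∣ : ∀ B → Filled G B 1 → 4 + k ≤ 2 + ∣ B ∣
  filled₁⇒n≤2+∣B∣ (x ∷ y ∷ z ∷ p) filled with leaves x y z p 1 filled
  ... | inj₁ full = s≤s (s≤s (ℕ.≤-trans (s≤s full) (extra x y z filled)))
    where
    extra : ∀ x y z → Filled G (x ∷ y ∷ z ∷ p) 1 → 1 + ∣ p ∣ ≤ ∣ x ∷ y ∷ z ∷ p ∣
    extra inside y z _ = s≤s (ℕ.≤-trans (∣p∣≤∣x∷p∣ z p) (∣p∣≤∣x∷p∣ y (z ∷ p)))
    extra outside inside z _ = s≤s (∣p∣≤∣x∷p∣ z p)
    extra outside outside inside _ = ℕ.≤-refl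
    extra outside outside outside filled =
      ⊥-elim (abc (outside ∷ outside ∷ outside ∷ p) filled
      ((λ ()) ∷ (λ { (there ()) }) ∷ (λ { (there (there ())) }) ∷ []))
  -- One leaf is missing, so at most one of `a`, `b`, `c` may be: any two of them complete a
  -- forbidden triple.
  ... | inj₂ (i , i∉ , most) = s≤s (s≤s (ℕ.≤-trans (s≤s most) (extra x y z filled)))
    where
    leaf∉ : ∀ {x y z} → leaf i ∉ x ∷ y ∷ z ∷ p
    leaf∉ (there (there (there i∈))) = i∉ i∈

    extra : ∀ x y z → Filled G (x ∷ y ∷ z ∷ p) 1 → 2 + ∣ p ∣ ≤ ∣ x ∷ y ∷ z ∷ p ∣
    extra inside inside z _ = s≤s (s≤s (∣p∣≤∣x∷p∣ z p))
    extra inside outside inside _ = ℕ.≤-refl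
    extra outside inside inside _ = ℕ.≤-refl
    extra inside outside outside filled =
      ⊥-elim (bcl i (inside ∷ outside ∷ outside ∷ p) filled
      ((λ { (there ()) }) ∷ (λ { (there (there ())) }) ∷ leaf∉ ∷ []))
    extra outside inside outside filled =
      ⊥-elim (acl i (outside ∷ inside ∷ outside ∷ p) filled
      ((λ ()) ∷ (λ { (there (there ())) }) ∷ leaf∉ ∷ []))
    extra outside outside z filled =
      ⊥-elim (abl i (outside ∷ outside ∷ z ∷ p) filled
      ((λ ()) ∷ (λ { (there ()) }) ∷ leaf∉ ∷ []))

  filled₀⇒∣B∣≡n : ∀ {B} → Filled G B 0 → ∣ B ∣ ≡ 4 + k
  filled₀⇒∣B∣≡n filled = trans (cong ∣_∣ filled) (∣⊤∣≡n (4 + k))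

  -- With n = 4 + k, filling in 0, 1 or at least 2 steps takes at least n, n - 2 or n - 3 initial
  -- vertices respectively; the extra steps make up for the smaller set.
  lower : LowerBounds G
  lower = lower-bounds (thZ-≥ G sum-bound) (λ e → thZ*-≥ G e product-bound)
    where
    sum-bound : ∀ B t → Filled G B t → 3 + k ≤ ∣ B ∣ + t
    sum-bound B 0 filled = ℕ.≤-trans (ℕ.n≤1+n _)
      (ℕ.≤-reflexive (sym (trans (ℕ.+-identityʳ _) (filled₀⇒∣B∣≡n {B} filled))))
    sum-bound B 1 filled = subst (3 + k ≤_) (ℕ.+-comm 1 ∣ B ∣)
      (ℕ.∸-monoˡ-≤ 1 (filled₁⇒n≤2+∣B∣ B filled))
    sum-bound B t@(suc (suc s)) filled =
      ℕ.≤-trans (ℕ.∸-monoˡ-≤ 1 (filled⇒n≤3+∣B∣ B t filled))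
        (subst (2 + ∣ B ∣ ≤_) (ℕ.+-comm t ∣ B ∣) (s≤s (s≤s (ℕ.m≤n+m ∣ B ∣ s))))

    product-bound : ∀ B t → ∣ B ∣ ≤ 3 + k → Filled G B t → 2 + k ≤ ∣ B ∣ * t
    product-bound B 0 ∣B∣<n filled =
      contradiction (subst (_≤ 3 + k) (filled₀⇒∣B∣≡n {B} filled) ∣B∣<n) (ℕ.<-irrefl refl)
    product-bound B 1 _ filled = subst (2 + k ≤_) (sym (ℕ.*-identityʳ ∣ B ∣))
      (ℕ.∸-monoˡ-≤ 2 (filled₁⇒n≤2+∣B∣ B filled))
    -- The product is at least 2(n - 3) = 2 + 2k, which is at least n - 2 = 2 + k.
    product-bound B t@(suc (suc s)) _ filled =
      ℕ.≤-trans (s≤s (s≤s (ℕ.m≤m*n k 2)))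
        (ℕ.*-mono-≤ (ℕ.∸-monoˡ-≤ 3 (filled⇒n≤3+∣B∣ B t filled)) (s≤s (s≤s (z≤n {s}))))

-- The brooms and their complements

arc : ∀ {k} → Fin (4 + k) → Fin (4 + k) → Bool
arc a b = true
arc b c = true
arc c (leaf _) = true
arc _ _ = false

adj : ∀ {k} → Fin (4 + k) → Fin (4 + k) → Bool
adj u v = arc u v ∨ arc v u

-- There are 1 + k leaves; k = 0 gives the path on four vertices. Boolean adjacency lets concrete
-- edges reduce to the unit type and non-edges to the empty type, so `_` and absurd patterns settle
-- them.
broom : ∀ k → Graph (4 + k)
broom k = record
  { nonempty = s≤s z≤n
  ; _~_ = λ u v → T (adj u v)
  ; _~?_ = λ u v → T? (adj u v)
  ; ~-sym = λ {u} {v} → subst T (∨-comm (arc u v) (arc v u))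
  ; ~-irrefl = λ { {a} refl () ; {b} refl () ; {c} refl () ; {leaf _} refl () }
  }

brooms : ℕ → ∃ Graph
brooms k = 4 + k , broom k

hub⇒connected : ∀ {n} (G : Graph n) h → (∀ u → Star (Graph._~_ G) u h) → Connected G
hub⇒connected G h to-h u v = to-h u ◅◅ reverse (Graph.~-sym G) (to-h v)

module _ (k : ℕ) where

  broom-connected : Connected (broom k)
  broom-connected = hub⇒connected (broom k) c λ
    { a → _◅_ {j = b} _ (_ ◅ ε) ; b → _ ◅ ε ; c → ε ; (leaf _) → _ ◅ ε }

  broomᶜ-connected : Connected (broom k ᶜ)
  broomᶜ-connected = hub⇒connected (broom k ᶜ) (leaf zero) λ
    { a → ((λ ()) , λ ()) ◅ ε
    ; b → ((λ ()) , λ ()) ◅ ε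
    -- In the complement `a` is the only neighbour of `c`.
    ; c → _◅_ {j = a} ((λ ()) , λ ()) (((λ ()) , λ ()) ◅ ε)
    ; (leaf zero) → ε
    ; (leaf (suc _)) → ((λ ()) , λ ()) ◅ ε }

  broom-lower : LowerBounds (broom k)
  broom-lower = lower G twins
    (λ { i B t filled (a∉ ∷ b∉ ∷ _ ∷ l∉ ∷ []) →
      fort⇒not-filled G B t (fort i) filled (a∉ ∷ b∉ ∷ l∉ ∷ []) })
    (λ { B filled (a∉ ∷ b∉ ∷ _) → ab B filled (a∉ ∷ b∉ ∷ []) })
    (λ { i B filled (a∉ ∷ b∉ ∷ _) → ab B filled (a∉ ∷ b∉ ∷ []) })
    (λ { i B filled (_ ∷ ∉s) → cl i B filled ∉s })
    (λ { i B filled (_ ∷ ∉s) → cl i B filled ∉s })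
    where
    G = broom k

    twins : ∀ {i j} → i ≢ j → Fort G (leaf i ∷ leaf j ∷ [])
    twins i≢j =
      (λ { c _ → inj₂ (_ , there (here refl) , (λ { refl → i≢j refl }) , _) }) ∷
      (λ { c _ → inj₂ (_ , here refl , (λ { refl → i≢j refl }) , _) }) ∷ []

    -- The only outside vertex adjacent to this set is `c`, which sees both `b` and the leaf.
    fort : ∀ i → Fort G (a ∷ b ∷ leaf i ∷ [])
    fort i =
      (λ { b _ → inj₁ (there (here refl)) ; c () ; (leaf _) () }) ∷
      (λ { a _ → inj₁ (here refl)
         ; c _ → inj₂ (_ , there (there (here refl)) , (λ ()) , _) }) ∷
      (λ { c _ → inj₂ (_ , there (here refl) , (λ ()) , _) }) ∷ []

    -- Here `a` is pendant at `b`, as below the leaf is pendant at `c`: a pendant vertex cannot be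
    -- forced while its neighbour is unfilled.
    ab : ∀ B → Filled G B 1 → ¬ All (_∉ B) (a ∷ b ∷ [])
    ab = blocked⇒not-at-once G {w = a}
      (λ { b _ → inj₁ (there (here refl)) ; c () ; (leaf _) () }) (here refl)

    cl : ∀ i B → Filled G B 1 → ¬ All (_∉ B) (c ∷ leaf i ∷ [])
    cl i = blocked⇒not-at-once G {w = leaf i} (λ { c _ → inj₁ (here refl) }) (there (here refl))

  broomᶜ-lower : LowerBounds (broom k ᶜ)
  broomᶜ-lower = lower G twins
    (λ i B t → fort⇒not-filled G B t (fort i))
    (λ { B filled (a∉ ∷ _ ∷ c∉ ∷ []) → ac B filled (a∉ ∷ c∉ ∷ []) })
    (λ { i B filled (a∉ ∷ b∉ ∷ _) → ab B filled (a∉ ∷ b∉ ∷ []) })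
    (λ { i B filled (a∉ ∷ c∉ ∷ _) → ac B filled (a∉ ∷ c∉ ∷ []) })
    (λ { i B filled (_ ∷ ∉s) → cl i B filled ∉s })
    where
    G = broom k ᶜ

    twins : ∀ {i j} → i ≢ j → Fort G (leaf i ∷ leaf j ∷ [])
    twins {i} {j} i≢j = dominated (there (here refl)) i≢j ∷ dominated (here refl) (i≢j ∘ sym) ∷ []
      where
      -- In the complement every neighbour of one leaf, other than the second leaf itself, is also a
      -- neighbour of the second.
      dominated : ∀ {F i j} → leaf j ∈ˡ F → i ≢ j → Blocked G F (leaf i)
      dominated j∈F i≢j a _ = inj₂ (_ , j∈F , (λ { refl → i≢j refl }) , (λ ()) , λ ())
      dominated j∈F i≢j b _ = inj₂ (_ , j∈F , (λ { refl → i≢j refl }) , (λ ()) , λ ())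
      dominated j∈F i≢j c (_ , c≁) = ⊥-elim (c≁ _)
      dominated {j = j} j∈F i≢j (leaf v) _ with v ≟ᶠ j
      ... | yes refl = inj₁ j∈F
      ... | no v≢j = inj₂ (_ , j∈F , (λ { refl → i≢j refl }) , (λ { refl → v≢j refl }) , λ ())

    -- Outside this set there are only leaves, and each of them sees both `a` and `b` in the
    -- complement.
    fort : ∀ i → Fort G (a ∷ b ∷ c ∷ leaf i ∷ [])
    fort i =
      (λ { a _ → inj₁ (here refl)
         ; b _ → inj₁ (there (here refl))
         ; c _ → inj₁ (there (there (here refl)))
         ; (leaf _) _ → inj₂ (b , there (here refl) , (λ ()) , (λ ()) , λ ()) }) ∷
      (λ { a _ → inj₁ (here refl)
         ; b _ → inj₁ (there (here refl))
         ; c _ → inj₁ (there (there (here refl)))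
         ; (leaf _) _ → inj₂ (a , here refl , (λ ()) , (λ ()) , λ ()) }) ∷
      (λ { a _ → inj₁ (here refl)
         ; b _ → inj₁ (there (here refl))
         ; c _ → inj₁ (there (there (here refl)))
         ; (leaf _) (_ , l≁c) → ⊥-elim (l≁c _) }) ∷
      (λ { a _ → inj₁ (here refl)
         ; b _ → inj₁ (there (here refl))
         ; c _ → inj₁ (there (there (here refl)))
         ; (leaf _) _ → inj₂ (a , here refl , (λ ()) , (λ ()) , λ ()) }) ∷ []

    only-a : ∀ {v} → Graph._~_ G v c → v ≡ a
    only-a {a} _ = refl
    only-a {b} (_ , b≁c) = ⊥-elim (b≁c _)
    only-a {c} (c≢c , _) = ⊥-elim (c≢c refl)
    only-a {leaf _} (_ , l≁c) = ⊥-elim (l≁c _)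

    ac : ∀ B → Filled G B 1 → ¬ All (_∉ B) (a ∷ c ∷ [])
    ac = blocked⇒not-at-once G {w = c}
      (λ v v~c → inj₁ (here (only-a v~c))) (there (here refl))

    -- Only `a` could force `c`, but `a` also sees the unfilled leaf.
    cl : ∀ i B → Filled G B 1 → ¬ All (_∉ B) (c ∷ leaf i ∷ [])
    cl i = blocked⇒not-at-once G {w = c}
      (λ v v~c → inj₂ (leaf i , there (here refl) , (λ ()) ,
        subst (λ v → Graph._~_ G v (leaf i)) (sym (only-a v~c)) ((λ ()) , λ ())))
      (here refl)

    -- In the complement `b` has only leaves as neighbours, and they all see `a`.
    ab : ∀ B → Filled G B 1 → ¬ All (_∉ B) (a ∷ b ∷ [])
    ab = blocked⇒not-at-once G {w = b}
      (λ { a _ → inj₁ (here refl)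
         ; b _ → inj₁ (there (here refl))
         ; c (_ , c≁b) → ⊥-elim (c≁b _)
         ; (leaf _) _ → inj₂ (a , here refl , (λ ()) , (λ ()) , λ ()) })
      (there (here refl))

  brooms-extremal : Extremal (proj₂ (brooms k))
  brooms-extremal = record
    { 4≤n = s≤s (s≤s (s≤s (s≤s z≤n)))
    ; connected = broom-connected
    ; connectedᶜ = broomᶜ-connected
    ; lowerBounds = broom-lower
    ; lowerBoundsᶜ = broomᶜ-lower
    }

-- The orders 4 + i and 4 + j already differ.
brooms-distinct : ∀ {i j} → i ≢ j → ¬ proj₂ (brooms i) ≅ proj₂ (brooms j)
brooms-distinct i≢j (φ , _) = i≢j (ℕ.+-cancelˡ-≡ 4 _ _ (↔⇒≡ φ))

proposition2p5 : (∀ (n : ℕ) (G : Graph n) → 4 ≤ n → Connected G → Connected (G ᶜ) →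
    (thZ G + thZ (G ᶜ) ≤ 2 * (n ∸ 1)) ×
    (thZ G * thZ (G ᶜ) ≤ (n ∸ 1) ^ 2) ×
    Σ (HasEdge G) (λ e → Σ (HasEdge (G ᶜ)) (λ e′ →
    (thZ* G e + thZ* (G ᶜ) e′ ≤ 2 * (n ∸ 2)) ×
    (thZ* G e * thZ* (G ᶜ) e′ ≤ (n ∸ 2) ^ 2)))) ×
    InfinitelyMany (λ {n} G → 4 ≤ n × Connected G × Connected (G ᶜ) ×
    thZ G + thZ (G ᶜ) ≡ 2 * (n ∸ 1)) ×
    InfinitelyMany (λ {n} G → 4 ≤ n × Connected G × Connected (G ᶜ) ×
    thZ G * thZ (G ᶜ) ≡ (n ∸ 1) ^ 2) ×
    InfinitelyMany (λ {n} G → 4 ≤ n × Connected G × Connected (G ᶜ) ×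
    Σ (HasEdge G) (λ e → Σ (HasEdge (G ᶜ)) (λ e′ →
    thZ* G e + thZ* (G ᶜ) e′ ≡ 2 * (n ∸ 2)))) ×
    InfinitelyMany (λ {n} G → 4 ≤ n × Connected G × Connected (G ᶜ) ×
    Σ (HasEdge G) (λ e → Σ (HasEdge (G ᶜ)) (λ e′ →
    thZ* G e * thZ* (G ᶜ) e′ ≡ (n ∸ 2) ^ 2)))
proposition2p5 =
  (λ n G 4≤n con conᶜ →
    let 2≤n = ℕ.≤-trans (s≤s (s≤s z≤n)) 4≤n
        th≤ , th*≤ = upper G 2≤n con conᶜ
        thᶜ≤ , thᶜ*≤ = upperᶜ G 2≤n con conᶜ
        e = hasEdge G 2≤n con conᶜ
        e′ = hasEdgeᶜ G 2≤n con conᶜ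
    in m≤o∧n≤o⇒m+n≤2*o th≤ thᶜ≤ ,
       m≤o∧n≤o⇒m*n≤o^2 th≤ thᶜ≤ ,
       e , e′ ,
       m≤o∧n≤o⇒m+n≤2*o (th*≤ e) (thᶜ*≤ e′) ,
       m≤o∧n≤o⇒m*n≤o^2 (th*≤ e) (thᶜ*≤ e′)) ,
  (brooms , (λ k → let open Extremal (brooms-extremal k) in
    4≤n , connected , connectedᶜ , trans (cong₂ _+_ thZ≡ thZᶜ≡) (m+m≡2*m (3 + k))) ,
    brooms-distinct) ,
  (brooms , (λ k → let open Extremal (brooms-extremal k) in
    4≤n , connected , connectedᶜ , trans (cong₂ _*_ thZ≡ thZᶜ≡) (m*m≡m^2 (3 + k))) ,
    brooms-distinct) ,
  (brooms , (λ k → let open Extremal (brooms-extremal k) in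
    4≤n , connected , connectedᶜ , edge , edgeᶜ ,
    trans (cong₂ _+_ (thZ*≡ edge) (thZ*ᶜ≡ edgeᶜ)) (m+m≡2*m (2 + k))) ,
    brooms-distinct) ,
  brooms , (λ k → let open Extremal (brooms-extremal k) in
    4≤n , connected , connectedᶜ , edge , edgeᶜ ,
    trans (cong₂ _*_ (thZ*≡ edge) (thZ*ᶜ≡ edgeᶜ)) (m*m≡m^2 (2 + k))) ,
    brooms-distinct
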